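{- For all $n\in\mathbb N$ and all integers $d\geq 1$, $$\sum_{k=0}^nU_{d-1}\circ T_{(d+1)^k}\prod_{j=0}^k\frac{1}{U_d\circ T_{(d+1)^j}}=\frac{U_{(d+1)^{n+1}-2}}{U_{(d+1)^{n+1}-1}}$$ as rational fractions in $x$.
   Context: $T_n=T_n(x)$ and $U_n=U_n(x)$ denote the Chebyshev polynomials of the first and second kind, defined by $T_0=1$, $T_1=x$, $T_{n+1}=2xT_n-T_{n-1}$ and $U_0=1$, $U_1=2x$, $U_{n+1}=2xU_n-U_{n-1}$ for $n\geq1$. The symbol $\circ$ denotes composition of polynomials. -}

module Defs where

open import Data.Nat.Base as ℕ using (ℕ; zero; suc)
open import Data.Integer.Base as ℤ using (ℤ; +_; 0ℤ; 1ℤ)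
open import Data.Integer.Properties as ℤ using (i*j≡0⇒i≡0∨j≡0)
open import Data.Integer.Tactic.RingSolver using (solve-∀)
open import Data.List.Base using (List; []; _∷_; map)
open import Data.Sum.Base as Sum using (_⊎_; inj₁; inj₂; [_,_]′)
open import Relation.Binary.PropositionalEquality
open import Relation.Nullary.Negation using (¬_)

open ≡-Reasoning

infixl 7 _*ₚ_ _*ᶠ_
infixl 6 _+ₚ_ _-ₚ_ _+ᶠ_
infixr 9 _∘ₚ_
infix  8 -ₚ_
infix  4 _≈ₚ_ _≉ₚ_ _≈ᶠ_

-- ℤ[x]: coefficients by increasing degree.  Trailing zeros are allowed, so
-- the equality of polynomials is _≈ₚ_ and not _≡_.
Poly : Set
Poly = List ℤ

coeff : Poly → ℕ → ℤ
coeff []      _       = 0ℤ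
coeff (a ∷ p) zero    = a
coeff (a ∷ p) (suc i) = coeff p i

_≈ₚ_ : Poly → Poly → Set
p ≈ₚ q = ∀ i → coeff p i ≡ coeff q i

_≉ₚ_ : Poly → Poly → Set
p ≉ₚ q = ¬ (p ≈ₚ q)

const : ℤ → Poly
const a = a ∷ []

0ₚ 1ₚ X : Poly
0ₚ = []
1ₚ = const 1ℤ
X  = 0ℤ ∷ 1ℤ ∷ []

_+ₚ_ : Poly → Poly → Poly
[]      +ₚ q       = q
(a ∷ p) +ₚ []      = a ∷ p
(a ∷ p) +ₚ (b ∷ q) = (a ℤ.+ b) ∷ (p +ₚ q)

-ₚ_ : Poly → Poly
-ₚ p = map ℤ.-_ p

_-ₚ_ : Poly → Poly → Poly
p -ₚ q = p +ₚ (-ₚ q)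

scale : ℤ → Poly → Poly
scale a p = map (a ℤ.*_) p

-- (a + x p) q = a q + x (p q)
_*ₚ_ : Poly → Poly → Poly
[]      *ₚ q = []
(a ∷ p) *ₚ q = scale a q +ₚ (0ℤ ∷ (p *ₚ q))

-- (a + x p) ∘ q = a + q (p ∘ q)
_∘ₚ_ : Poly → Poly → Poly
[]      ∘ₚ q = []
(a ∷ p) ∘ₚ q = const a +ₚ q *ₚ (p ∘ₚ q)

T : ℕ → Poly
T zero          = 1ₚ
T (suc zero)    = X
T (suc (suc n)) = const (+ 2) *ₚ X *ₚ T (suc n) -ₚ T n

U : ℕ → Poly
U zero          = 1ₚ
U (suc zero)    = const (+ 2) *ₚ X
U (suc (suc n)) = const (+ 2) *ₚ X *ₚ U (suc n) -ₚ U n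

coeff-+ : ∀ p q i → coeff (p +ₚ q) i ≡ coeff p i ℤ.+ coeff q i
coeff-+ []      q       i       = sym (ℤ.+-identityˡ _)
coeff-+ (a ∷ p) []      i       = sym (ℤ.+-identityʳ _)
coeff-+ (a ∷ p) (b ∷ q) zero    = refl
coeff-+ (a ∷ p) (b ∷ q) (suc i) = coeff-+ p q i

coeff-scale : ∀ a p i → coeff (scale a p) i ≡ a ℤ.* coeff p i
coeff-scale a []      i       = sym (ℤ.*-zeroʳ a)
coeff-scale a (b ∷ p) zero    = refl
coeff-scale a (b ∷ p) (suc i) = coeff-scale a p i

coeff-* : ∀ a p q i →
          coeff ((a ∷ p) *ₚ q) i ≡ a ℤ.* coeff q i ℤ.+ coeff (0ℤ ∷ (p *ₚ q)) i
coeff-* a p q i =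
  trans (coeff-+ (scale a q) _ i) (cong (ℤ._+ _) (coeff-scale a q i))

*ₚ-shiftʳ : ∀ p q → p *ₚ (0ℤ ∷ q) ≈ₚ 0ℤ ∷ (p *ₚ q)
*ₚ-shiftʳ []      q zero    = refl
*ₚ-shiftʳ []      q (suc i) = refl
*ₚ-shiftʳ (a ∷ p) q zero    =
  trans (coeff-* a p (0ℤ ∷ q) 0) (cong (ℤ._+ 0ℤ) (ℤ.*-zeroʳ a))
*ₚ-shiftʳ (a ∷ p) q (suc i) = begin
  coeff ((a ∷ p) *ₚ (0ℤ ∷ q)) (suc i)             ≡⟨ coeff-* a p (0ℤ ∷ q) (suc i) ⟩
  a ℤ.* coeff q i ℤ.+ coeff (p *ₚ (0ℤ ∷ q)) i     ≡⟨ cong (ℤ._+_ (a ℤ.* coeff q i)) (*ₚ-shiftʳ p q i) ⟩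
  a ℤ.* coeff q i ℤ.+ coeff (0ℤ ∷ (p *ₚ q)) i     ≡⟨ coeff-* a p q i ⟨
  coeff ((a ∷ p) *ₚ q) i                          ∎

0∷-≈0 : ∀ {a p} → a ≡ 0ℤ → p ≈ₚ 0ₚ → a ∷ p ≈ₚ 0ₚ
0∷-≈0 a≡0 p≈0 zero    = a≡0
0∷-≈0 a≡0 p≈0 (suc i) = p≈0 i

cancel-xˡ : ∀ {a} p q → a ≡ 0ℤ → (a ∷ p) *ₚ q ≈ₚ 0ₚ → p *ₚ q ≈ₚ 0ₚ
cancel-xˡ p q refl h i = begin
  coeff (p *ₚ q) i                                   ≡⟨ ℤ.+-identityˡ _ ⟨
  0ℤ ℤ.* coeff q (suc i) ℤ.+ coeff (p *ₚ q) i        ≡⟨ coeff-* 0ℤ p q (suc i) ⟨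
  coeff ((0ℤ ∷ p) *ₚ q) (suc i)                      ≡⟨ h (suc i) ⟩
  0ℤ                                                 ∎

cancel-xʳ : ∀ {b} p q → b ≡ 0ℤ → p *ₚ (b ∷ q) ≈ₚ 0ₚ → p *ₚ q ≈ₚ 0ₚ
cancel-xʳ p q refl h i = trans (sym (*ₚ-shiftʳ p q (suc i))) (h (suc i))

p*q≈0⇒p≈0∨q≈0 : ∀ p q → p *ₚ q ≈ₚ 0ₚ → p ≈ₚ 0ₚ ⊎ q ≈ₚ 0ₚ
p*q≈0⇒p≈0∨q≈0 []      q       h = inj₁ λ _ → refl
p*q≈0⇒p≈0∨q≈0 (a ∷ p) []      h = inj₂ λ _ → refl
p*q≈0⇒p≈0∨q≈0 (a ∷ p) (b ∷ q) h
  = [ (λ a≡0 → Sum.map₁ (0∷-≈0 a≡0)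
                 (p*q≈0⇒p≈0∨q≈0 p (b ∷ q) (cancel-xˡ p (b ∷ q) a≡0 h)))
    , (λ b≡0 → Sum.map₂ (0∷-≈0 b≡0)
                 (p*q≈0⇒p≈0∨q≈0 (a ∷ p) q (cancel-xʳ (a ∷ p) q b≡0 h)))
    ]′ (i*j≡0⇒i≡0∨j≡0 a (trans (sym (ℤ.+-identityʳ (a ℤ.* b))) (h 0)))

*ₚ-≉0 : ∀ p q → p ≉ₚ 0ₚ → q ≉ₚ 0ₚ → p *ₚ q ≉ₚ 0ₚ
*ₚ-≉0 p q p≉0 q≉0 h = [ p≉0 , q≉0 ]′ (p*q≈0⇒p≈0∨q≈0 p q h)

-- Denominators are shown to be nonzero by evaluating at 1, where Tₙ(1) = 1
-- and Uₙ(1) = n + 1.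
eval : Poly → ℤ → ℤ
eval []      x = 0ℤ
eval (a ∷ p) x = a ℤ.+ x ℤ.* eval p x

eval-≈0 : ∀ p x → p ≈ₚ 0ₚ → eval p x ≡ 0ℤ
eval-≈0 []      x h = refl
eval-≈0 (a ∷ p) x h =
  trans (cong₂ (λ a e → a ℤ.+ x ℤ.* e) (h 0) (eval-≈0 p x λ i → h (suc i)))
        (trans (ℤ.+-identityˡ _) (ℤ.*-zeroʳ x))

eval-+ : ∀ p q x → eval (p +ₚ q) x ≡ eval p x ℤ.+ eval q x
eval-+ []      q       x = sym (ℤ.+-identityˡ _)
eval-+ (a ∷ p) []      x = sym (ℤ.+-identityʳ _)
eval-+ (a ∷ p) (b ∷ q) x =
  trans (cong (λ e → a ℤ.+ b ℤ.+ x ℤ.* e) (eval-+ p q x))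
        (rearrange a b x (eval p x) (eval q x))
  where
  rearrange : ∀ a b x e f → a ℤ.+ b ℤ.+ x ℤ.* (e ℤ.+ f) ≡
                            (a ℤ.+ x ℤ.* e) ℤ.+ (b ℤ.+ x ℤ.* f)
  rearrange = solve-∀

eval-neg : ∀ p x → eval (-ₚ p) x ≡ ℤ.- eval p x
eval-neg []      x = refl
eval-neg (a ∷ p) x =
  trans (cong (λ e → ℤ.- a ℤ.+ x ℤ.* e) (eval-neg p x)) (rearrange a x (eval p x))
  where
  rearrange : ∀ a x e → ℤ.- a ℤ.+ x ℤ.* (ℤ.- e) ≡ ℤ.- (a ℤ.+ x ℤ.* e)
  rearrange = solve-∀

eval-scale : ∀ a p x → eval (scale a p) x ≡ a ℤ.* eval p x
eval-scale a []      x = sym (ℤ.*-zeroʳ a)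
eval-scale a (b ∷ p) x =
  trans (cong (λ e → a ℤ.* b ℤ.+ x ℤ.* e) (eval-scale a p x))
        (rearrange a b x (eval p x))
  where
  rearrange : ∀ a b x e → a ℤ.* b ℤ.+ x ℤ.* (a ℤ.* e) ≡ a ℤ.* (b ℤ.+ x ℤ.* e)
  rearrange = solve-∀

eval-* : ∀ p q x → eval (p *ₚ q) x ≡ eval p x ℤ.* eval q x
eval-* []      q x = refl
eval-* (a ∷ p) q x = begin
  eval (scale a q +ₚ (0ℤ ∷ (p *ₚ q))) x                    ≡⟨ eval-+ (scale a q) _ x ⟩
  eval (scale a q) x ℤ.+ (0ℤ ℤ.+ x ℤ.* eval (p *ₚ q) x)
    ≡⟨ cong₂ (λ e f → e ℤ.+ (0ℤ ℤ.+ x ℤ.* f)) (eval-scale a q x) (eval-* p q x) ⟩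
  a ℤ.* eval q x ℤ.+ (0ℤ ℤ.+ x ℤ.* (eval p x ℤ.* eval q x)) ≡⟨ rearrange a x (eval p x) (eval q x) ⟩
  (a ℤ.+ x ℤ.* eval p x) ℤ.* eval q x                      ∎
  where
  rearrange : ∀ a x e f → a ℤ.* f ℤ.+ (0ℤ ℤ.+ x ℤ.* (e ℤ.* f)) ≡
                          (a ℤ.+ x ℤ.* e) ℤ.* f
  rearrange = solve-∀

eval-∘ : ∀ p q x → eval (p ∘ₚ q) x ≡ eval p (eval q x)
eval-∘ []      q x = refl
eval-∘ (a ∷ p) q x = begin
  eval (const a +ₚ q *ₚ (p ∘ₚ q)) x                  ≡⟨ eval-+ (const a) (q *ₚ (p ∘ₚ q)) x ⟩
  eval (const a) x ℤ.+ eval (q *ₚ (p ∘ₚ q)) x        ≡⟨ cong₂ ℤ._+_ (eval-const a x) (eval-* q (p ∘ₚ q) x) ⟩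
  a ℤ.+ eval q x ℤ.* eval (p ∘ₚ q) x                 ≡⟨ cong (λ e → a ℤ.+ eval q x ℤ.* e) (eval-∘ p q x) ⟩
  a ℤ.+ eval q x ℤ.* eval p (eval q x)               ∎
  where
  eval-const : ∀ a x → eval (const a) x ≡ a
  eval-const a x = trans (cong (ℤ._+_ a) (ℤ.*-zeroʳ x)) (ℤ.+-identityʳ a)

eval-step : ∀ p q → eval (const (+ 2) *ₚ X *ₚ p -ₚ q) 1ℤ ≡ + 2 ℤ.* eval p 1ℤ ℤ.- eval q 1ℤ
eval-step p q =
  trans (eval-+ (const (+ 2) *ₚ X *ₚ p) (-ₚ q) 1ℤ)
        (cong₂ ℤ._+_ (eval-* (const (+ 2) *ₚ X) p 1ℤ) (eval-neg q 1ℤ))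

T-at-1 : ∀ n → eval (T n) 1ℤ ≡ 1ℤ
T-at-1 zero          = refl
T-at-1 (suc zero)    = refl
T-at-1 (suc (suc n)) =
  trans (eval-step (T (suc n)) (T n))
        (cong₂ (λ e f → + 2 ℤ.* e ℤ.- f) (T-at-1 (suc n)) (T-at-1 n))

U-at-1 : ∀ n → eval (U n) 1ℤ ≡ + suc n
U-at-1 zero          = refl
U-at-1 (suc zero)    = refl
U-at-1 (suc (suc n)) =
  trans (eval-step (U (suc n)) (U n))
        (trans (cong₂ (λ e f → + 2 ℤ.* e ℤ.- f) (U-at-1 (suc n)) (U-at-1 n))
               (arith (+ n)))
  where
  arith : ∀ m → + 2 ℤ.* (+ 2 ℤ.+ m) ℤ.- (1ℤ ℤ.+ m) ≡ + 3 ℤ.+ m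
  arith = solve-∀

1≉0 : 1ₚ ≉ₚ 0ₚ
1≉0 h with () ← h 0

U≉0 : ∀ n → U n ≉ₚ 0ₚ
U≉0 n h with () ← trans (sym (U-at-1 n)) (eval-≈0 (U n) 1ℤ h)

U∘T≉0 : ∀ d m → U d ∘ₚ T m ≉ₚ 0ₚ
U∘T≉0 d m h with () ← begin
  + suc d                   ≡⟨ U-at-1 d ⟨
  eval (U d) 1ℤ             ≡⟨ cong (eval (U d)) (T-at-1 m) ⟨
  eval (U d) (eval (T m) 1ℤ) ≡⟨ eval-∘ (U d) (T m) 1ℤ ⟨
  eval (U d ∘ₚ T m) 1ℤ      ≡⟨ eval-≈0 (U d ∘ₚ T m) 1ℤ h ⟩
  0ℤ                        ∎

-- ℚ(x), as the field of fractions of the integral domain ℤ[x].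
record RatFun : Set where
  constructor _/_⟨_⟩
  field
    num   : Poly
    den   : Poly
    den≉0 : den ≉ₚ 0ₚ

_≈ᶠ_ : RatFun → RatFun → Set
(p / q ⟨ _ ⟩) ≈ᶠ (r / s ⟨ _ ⟩) = p *ₚ s ≈ₚ r *ₚ q

_+ᶠ_ : RatFun → RatFun → RatFun
(p / q ⟨ q≉0 ⟩) +ᶠ (r / s ⟨ s≉0 ⟩) = (p *ₚ s +ₚ r *ₚ q) / q *ₚ s ⟨ *ₚ-≉0 q s q≉0 s≉0 ⟩

_*ᶠ_ : RatFun → RatFun → RatFun
(p / q ⟨ q≉0 ⟩) *ᶠ (r / s ⟨ s≉0 ⟩) = (p *ₚ r) / q *ₚ s ⟨ *ₚ-≉0 q s q≉0 s≉0 ⟩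

ι : Poly → RatFun
ι p = p / 1ₚ ⟨ 1≉0 ⟩

-- Both bounds are inclusive: k (resp. j) ranges over 0, 1, …, n.
sum≤ prod≤ : ℕ → (ℕ → RatFun) → RatFun
sum≤ zero    f = f 0
sum≤ (suc n) f = sum≤ n f +ᶠ f (suc n)
prod≤ zero    f = f 0
prod≤ (suc n) f = prod≤ n f *ᶠ f (suc n)

infix 5 sum≤ prod≤
syntax sum≤  n (λ k → e) = ∑[ k ≤ n ] e
syntax prod≤ n (λ j → e) = ∏[ j ≤ n ] e

{-# OPTIONS --safe #-}

-- Write W n for the polynomial U_{n-2}, with U_{-2} = -1 and U_{-1} = 0, and
-- put b = d + 1.  The identity 2 T_m W_{m+i} = W_{2m+i} + W_i says that
-- k ↦ W_{km+j} satisfies the Chebyshev recurrence with T_m in place of x, so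
--   W_{km+j} = (W_{k+1} ∘ T_m) W_{m+j} - (W_k ∘ T_m) W_j.
-- For k = b the cases j = 1 and j = 0 read
--   U_{bm-1} = (U_d ∘ T_m) U_{m-1},
--   U_{bm-2} = (U_d ∘ T_m) U_{m-2} + U_{d-1} ∘ T_m.
-- With m = b^k the first telescopes the product to 1 / U_{b^{k+1}-1}, and the
-- second divided by the first shows that the k-th summand is
--   U_{bm-2} / U_{bm-1} - U_{m-2} / U_{m-1}.
module Submission where

open import Defs
open import Algebra.Bundles using (CommutativeRing)
import Algebra.Consequences.Propositional as Consequences
import Algebra.Consequences.Setoid as SetoidConsequences
open import Data.Integer.Base as ℤ using (ℤ; +_; 0ℤ; 1ℤ)
import Data.Integer.Properties as ℤ
open import Data.List.Base using ([]; _∷_)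
open import Data.List.Properties using (map-id; map-cong; map-∘)
open import Data.Maybe.Base using (Maybe; just; nothing)
open import Data.Nat.Base using (ℕ; zero; suc; _+_; _*_; _∸_; _^_; _≤_; z≤n; s≤s)
import Data.Nat.Properties as ℕ
open import Data.Product.Base using (_,_)
open import Level using (0ℓ)
open import Relation.Binary.PropositionalEquality
  using (_≡_; refl; sym; trans; cong; cong₂; subst₂; module ≡-Reasoning)
open import Relation.Binary.Bundles using (Setoid)
open import Relation.Binary.Structures using (IsEquivalence)
open import Tactic.RingSolver using (solve-∀)
open import Tactic.RingSolver.Core.AlmostCommutativeRing
  using (AlmostCommutativeRing; fromCommutativeRing)

-- A record, since p and q cannot be inferred from p ≈ₚ q, which unfolds.
infix 4 _≋_
record _≋_ (p q : Poly) : Set where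
  constructor mk≋
  field coeff-≡ : p ≈ₚ q
open _≋_

-- Polynomials up to trailing zeros as a setoid.

≋-isEquivalence : IsEquivalence _≋_
≋-isEquivalence = record
  { refl  = mk≋ λ _ → refl
  ; sym   = λ e → mk≋ λ i → sym (coeff-≡ e i)
  ; trans = λ e f → mk≋ λ i → trans (coeff-≡ e i) (coeff-≡ f i)
  }

≋-setoid : Setoid 0ℓ 0ℓ
≋-setoid = record { isEquivalence = ≋-isEquivalence }

private module ≋ = IsEquivalence ≋-isEquivalence

∷-cong : ∀ {a b p q} → a ≡ b → p ≋ q → a ∷ p ≋ b ∷ q
∷-cong a≡b p≋q = mk≋ λ { zero → a≡b ; (suc i) → coeff-≡ p≋q i }

0∷0≋0 : 0ℤ ∷ 0ₚ ≋ 0ₚ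
0∷0≋0 = mk≋ (0∷-≈0 refl λ _ → refl)

-- Commutative ring structure on ℤ[x]

+ₚ-cong : ∀ {p p′ q q′} → p ≋ p′ → q ≋ q′ → p +ₚ q ≋ p′ +ₚ q′
+ₚ-cong {p} {p′} {q} {q′} e f = mk≋ λ i →
  trans (coeff-+ p q i)
        (trans (cong₂ ℤ._+_ (coeff-≡ e i) (coeff-≡ f i)) (sym (coeff-+ p′ q′ i)))

+ₚ-congˡ : ∀ p {q r} → q ≋ r → p +ₚ q ≋ p +ₚ r
+ₚ-congˡ p = +ₚ-cong (≋.refl {p})

+ₚ-congʳ : ∀ p {q r} → q ≋ r → q +ₚ p ≋ r +ₚ p
+ₚ-congʳ p e = +ₚ-cong e (≋.refl {p})

+ₚ-comm : ∀ p q → p +ₚ q ≡ q +ₚ p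
+ₚ-comm []      []      = refl
+ₚ-comm []      (b ∷ q) = refl
+ₚ-comm (a ∷ p) []      = refl
+ₚ-comm (a ∷ p) (b ∷ q) = cong₂ _∷_ (ℤ.+-comm a b) (+ₚ-comm p q)

+ₚ-assoc : ∀ p q r → (p +ₚ q) +ₚ r ≡ p +ₚ (q +ₚ r)
+ₚ-assoc []      q       r       = refl
+ₚ-assoc (a ∷ p) []      r       = refl
+ₚ-assoc (a ∷ p) (b ∷ q) []      = refl
+ₚ-assoc (a ∷ p) (b ∷ q) (c ∷ r) = cong₂ _∷_ (ℤ.+-assoc a b c) (+ₚ-assoc p q r)

+ₚ-identityʳ : ∀ p → p +ₚ 0ₚ ≡ p
+ₚ-identityʳ p = +ₚ-comm p 0ₚ

+ₚ-middleFour : ∀ p q r s → (p +ₚ q) +ₚ (r +ₚ s) ≡ (p +ₚ r) +ₚ (q +ₚ s)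
+ₚ-middleFour = Consequences.comm∧assoc⇒middleFour +ₚ-comm +ₚ-assoc

-ₚ-cong : ∀ {p q} → p ≋ q → -ₚ p ≋ -ₚ q
-ₚ-cong {p} {q} e = mk≋ λ i →
  trans (coeff-neg p i) (trans (cong ℤ.-_ (coeff-≡ e i)) (sym (coeff-neg q i)))
  where
  coeff-neg : ∀ p i → coeff (-ₚ p) i ≡ ℤ.- coeff p i
  coeff-neg []      i       = refl
  coeff-neg (a ∷ p) zero    = refl
  coeff-neg (a ∷ p) (suc i) = coeff-neg p i

-ₚ-inverseˡ : ∀ p → (-ₚ p) +ₚ p ≋ 0ₚ
-ₚ-inverseˡ []      = ≋.refl
-ₚ-inverseˡ (a ∷ p) = ≋.trans (∷-cong (ℤ.+-inverseˡ a) (-ₚ-inverseˡ p)) 0∷0≋0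

scale-cong : ∀ a {p q} → p ≋ q → scale a p ≋ scale a q
scale-cong a {p} {q} e = mk≋ λ i →
  trans (coeff-scale a p i)
        (trans (cong (a ℤ.*_) (coeff-≡ e i)) (sym (coeff-scale a q i)))

scale-zero : ∀ p → scale 0ℤ p ≋ 0ₚ
scale-zero p = mk≋ λ i → coeff-scale 0ℤ p i

scale-one : ∀ p → scale 1ℤ p ≡ p
scale-one p = trans (map-cong ℤ.*-identityˡ p) (map-id p)

scale-distribˡ-+ : ∀ a p q → scale a (p +ₚ q) ≡ scale a p +ₚ scale a q
scale-distribˡ-+ a []      q       = refl
scale-distribˡ-+ a (b ∷ p) []      = refl
scale-distribˡ-+ a (b ∷ p) (c ∷ q) =
  cong₂ _∷_ (ℤ.*-distribˡ-+ a b c) (scale-distribˡ-+ a p q)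

scale-distribʳ-+ : ∀ a b p → scale (a ℤ.+ b) p ≡ scale a p +ₚ scale b p
scale-distribʳ-+ a b []      = refl
scale-distribʳ-+ a b (c ∷ p) =
  cong₂ _∷_ (ℤ.*-distribʳ-+ c a b) (scale-distribʳ-+ a b p)

scale-* : ∀ a p q → scale a p *ₚ q ≡ scale a (p *ₚ q)
scale-* a []      q = refl
scale-* a (b ∷ p) q = sym (trans
  (scale-distribˡ-+ a (scale b q) (0ℤ ∷ p *ₚ q))
  (cong₂ _+ₚ_
    (trans (sym (map-∘ q)) (map-cong (λ c → sym (ℤ.*-assoc a b c)) q))
    (cong₂ _∷_ (ℤ.*-zeroʳ a) (sym (scale-* a p q)))))

*ₚ-distribʳ-+ₚ : ∀ r p q → (p +ₚ q) *ₚ r ≡ p *ₚ r +ₚ q *ₚ r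
*ₚ-distribʳ-+ₚ r []      q       = refl
*ₚ-distribʳ-+ₚ r (a ∷ p) []      = sym (+ₚ-identityʳ _)
*ₚ-distribʳ-+ₚ r (a ∷ p) (b ∷ q) = trans
  (cong₂ (λ s t → s +ₚ (0ℤ ∷ t)) (scale-distribʳ-+ a b r) (*ₚ-distribʳ-+ₚ r p q))
  (+ₚ-middleFour (scale a r) (scale b r) (0ℤ ∷ p *ₚ r) (0ℤ ∷ q *ₚ r))

*ₚ-zeroʳ : ∀ p → p *ₚ 0ₚ ≋ 0ₚ
*ₚ-zeroʳ []      = ≋.refl
*ₚ-zeroʳ (a ∷ p) = ≋.trans (∷-cong refl (*ₚ-zeroʳ p)) 0∷0≋0

-- Mirror image of the defining clause of `_*ₚ_`; this is the inductive step of commutativity.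
*ₚ-∷ʳ : ∀ p b q → p *ₚ (b ∷ q) ≋ scale b p +ₚ (0ℤ ∷ p *ₚ q)
*ₚ-∷ʳ []      b q = ≋.sym 0∷0≋0
*ₚ-∷ʳ (a ∷ p) b q = ∷-cong (cong (ℤ._+ 0ℤ) (ℤ.*-comm a b))
  (≋.trans (+ₚ-congˡ (scale a q) (*ₚ-∷ʳ p b q))
           (≋.reflexive (begin
    scale a q +ₚ (scale b p +ₚ (0ℤ ∷ p *ₚ q))  ≡⟨ +ₚ-assoc (scale a q) (scale b p) _ ⟨
    (scale a q +ₚ scale b p) +ₚ (0ℤ ∷ p *ₚ q)  ≡⟨ cong (_+ₚ (0ℤ ∷ p *ₚ q)) (+ₚ-comm (scale a q) _) ⟩
    (scale b p +ₚ scale a q) +ₚ (0ℤ ∷ p *ₚ q)  ≡⟨ +ₚ-assoc (scale b p) (scale a q) _ ⟩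
    scale b p +ₚ (scale a q +ₚ (0ℤ ∷ p *ₚ q))  ∎)))
  where open ≡-Reasoning

*ₚ-comm : ∀ p q → p *ₚ q ≋ q *ₚ p
*ₚ-comm []      q = ≋.sym (*ₚ-zeroʳ q)
*ₚ-comm (a ∷ p) q =
  ≋.trans (+ₚ-congˡ (scale a q) (∷-cong refl (*ₚ-comm p q)))
          (≋.sym (*ₚ-∷ʳ q a p))

*ₚ-congˡ : ∀ p {q r} → q ≋ r → p *ₚ q ≋ p *ₚ r
*ₚ-congˡ []      e = ≋.refl
*ₚ-congˡ (a ∷ p) e = +ₚ-cong (scale-cong a e) (∷-cong refl (*ₚ-congˡ p e))

-- Equal polynomials may be lists of different lengths, which obstructs recursion on the left
-- factors. Commutativity moves the varying factor to the right, where `*ₚ-congˡ` applies.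
*ₚ-cong : ∀ {p p′ q q′} → p ≋ p′ → q ≋ q′ → p *ₚ q ≋ p′ *ₚ q′
*ₚ-cong {p} {p′} {q} {q′} e f =
  ≋.trans (*ₚ-congˡ p f)
  (≋.trans (*ₚ-comm p q′) (≋.trans (*ₚ-congˡ q′ e) (*ₚ-comm q′ p′)))

*ₚ-congʳ : ∀ p {q r} → q ≋ r → q *ₚ p ≋ r *ₚ p
*ₚ-congʳ p e = *ₚ-cong e (≋.refl {p})

const-*ₚ : ∀ a p → const a *ₚ p ≋ scale a p
const-*ₚ a p = ≋.trans (+ₚ-congˡ (scale a p) 0∷0≋0)
                       (≋.reflexive (+ₚ-identityʳ (scale a p)))

*ₚ-identityˡ : ∀ p → 1ₚ *ₚ p ≋ p
*ₚ-identityˡ p = ≋.trans (const-*ₚ 1ℤ p) (≋.reflexive (scale-one p))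

*ₚ-assoc : ∀ p q r → (p *ₚ q) *ₚ r ≋ p *ₚ (q *ₚ r)
*ₚ-assoc []      q r = ≋.refl
*ₚ-assoc (a ∷ p) q r =
  ≋.trans (≋.reflexive (*ₚ-distribʳ-+ₚ r (scale a q) (0ℤ ∷ p *ₚ q)))
          (+ₚ-cong (≋.reflexive (scale-* a q r))
                   (+ₚ-cong (scale-zero r) (∷-cong refl (*ₚ-assoc p q r))))

≋-commutativeRing : CommutativeRing 0ℓ 0ℓ
≋-commutativeRing = record
  { Carrier = Poly
  ; _≈_     = _≋_
  ; _+_     = _+ₚ_
  ; _*_     = _*ₚ_
  ; -_      = -ₚ_
  ; 0#      = 0ₚ
  ; 1#      = 1ₚ
  ; isCommutativeRing = record
    { isRing = record
      { +-isAbelianGroup = record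
        { isGroup = record
          { isMonoid = record
            { isSemigroup = record
              { isMagma = record { isEquivalence = ≋-isEquivalence ; ∙-cong = +ₚ-cong }
              ; assoc   = λ p q r → ≋.reflexive (+ₚ-assoc p q r)
              }
            ; identity = (λ _ → ≋.refl) , (λ p → ≋.reflexive (+ₚ-identityʳ p))
            }
          ; inverse = comm∧invˡ⇒inv ≋-+-comm -ₚ-inverseˡ
          ; ⁻¹-cong = -ₚ-cong
          }
        ; comm = ≋-+-comm
        }
      ; *-cong     = *ₚ-cong
      ; *-assoc    = *ₚ-assoc
      ; *-identity = comm∧idˡ⇒id *ₚ-comm *ₚ-identityˡ
      ; distrib    = comm∧distrʳ⇒distr +ₚ-cong *ₚ-comm
                       λ r p q → ≋.reflexive (*ₚ-distribʳ-+ₚ r p q)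
      }
    ; *-comm = *ₚ-comm
    }
  }
  where
  open SetoidConsequences ≋-setoid
  ≋-+-comm : ∀ p q → p +ₚ q ≋ q +ₚ p
  ≋-+-comm p q = ≋.reflexive (+ₚ-comm p q)

ℤ[x] : AlmostCommutativeRing 0ℓ 0ℓ
ℤ[x] = fromCommutativeRing ≋-commutativeRing 0≟
  where
  -- The zero test of the ring solver. Any list of zeros represents the zero polynomial, hence the
  -- recursion.
  0≟ : ∀ p → Maybe (0ₚ ≋ p)
  0≟ []         = just ≋.refl
  0≟ (+ 0 ∷ p) with 0≟ p
  ... | just e  = just (≋.trans (≋.sym 0∷0≋0) (∷-cong refl e))
  ... | nothing = nothing
  0≟ (_ ∷ _)    = nothing

open import Relation.Binary.Reasoning.Setoid ≋-setoid

-- Composition is a ring homomorphism in its first argument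

∘ₚ-+ₚ : ∀ p q r → (p +ₚ q) ∘ₚ r ≋ p ∘ₚ r +ₚ q ∘ₚ r
∘ₚ-+ₚ []      q       r = ≋.refl
∘ₚ-+ₚ (a ∷ p) []      r = ≋.reflexive (sym (+ₚ-identityʳ _))
∘ₚ-+ₚ (a ∷ p) (b ∷ q) r = begin
  -- `const (a ℤ.+ b)` computes from this sum, which lets the solver treat the two constants as
  -- separate atoms.
  (const a +ₚ const b) +ₚ r *ₚ ((p +ₚ q) ∘ₚ r)     ≈⟨ +ₚ-congˡ (const (a ℤ.+ b)) (*ₚ-congˡ r (∘ₚ-+ₚ p q r)) ⟩
  (const a +ₚ const b) +ₚ r *ₚ (p ∘ₚ r +ₚ q ∘ₚ r)  ≈⟨ rearrange (const a) (const b) r (p ∘ₚ r) (q ∘ₚ r) ⟩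
  (a ∷ p) ∘ₚ r +ₚ (b ∷ q) ∘ₚ r                    ∎
  where
  rearrange : ∀ a b r s t → (a +ₚ b) +ₚ r *ₚ (s +ₚ t) ≋ (a +ₚ r *ₚ s) +ₚ (b +ₚ r *ₚ t)
  rearrange = solve-∀ ℤ[x]

∘ₚ--ₚ : ∀ p r → (-ₚ p) ∘ₚ r ≋ -ₚ (p ∘ₚ r)
∘ₚ--ₚ []      r = ≋.refl
∘ₚ--ₚ (a ∷ p) r = begin
  (-ₚ const a) +ₚ r *ₚ ((-ₚ p) ∘ₚ r)  ≈⟨ +ₚ-congˡ (-ₚ const a) (*ₚ-congˡ r (∘ₚ--ₚ p r)) ⟩
  (-ₚ const a) +ₚ r *ₚ (-ₚ (p ∘ₚ r))  ≈⟨ rearrange (const a) r (p ∘ₚ r) ⟩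
  -ₚ ((a ∷ p) ∘ₚ r)                  ∎
  where
  rearrange : ∀ a r s → (-ₚ a) +ₚ r *ₚ (-ₚ s) ≋ -ₚ (a +ₚ r *ₚ s)
  rearrange = solve-∀ ℤ[x]

∘ₚ-scale : ∀ a p r → scale a p ∘ₚ r ≋ const a *ₚ (p ∘ₚ r)
∘ₚ-scale a []      r = ≋.sym (*ₚ-zeroʳ (const a))
∘ₚ-scale a (b ∷ p) r = begin
  scale a (const b) +ₚ r *ₚ (scale a p ∘ₚ r)
    ≈⟨ +ₚ-cong (≋.sym (const-*ₚ a (const b))) (*ₚ-congˡ r (∘ₚ-scale a p r)) ⟩
  const a *ₚ const b +ₚ r *ₚ (const a *ₚ (p ∘ₚ r))
    ≈⟨ rearrange (const a) (const b) r (p ∘ₚ r) ⟩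
  const a *ₚ ((b ∷ p) ∘ₚ r)  ∎
  where
  rearrange : ∀ a b r s → a *ₚ b +ₚ r *ₚ (a *ₚ s) ≋ a *ₚ (b +ₚ r *ₚ s)
  rearrange = solve-∀ ℤ[x]

∘ₚ-*ₚ : ∀ p q r → (p *ₚ q) ∘ₚ r ≋ (p ∘ₚ r) *ₚ (q ∘ₚ r)
∘ₚ-*ₚ []      q r = ≋.refl
∘ₚ-*ₚ (a ∷ p) q r = begin
  (scale a q +ₚ (0ℤ ∷ p *ₚ q)) ∘ₚ r
    ≈⟨ ∘ₚ-+ₚ (scale a q) (0ℤ ∷ p *ₚ q) r ⟩
  scale a q ∘ₚ r +ₚ (const 0ℤ +ₚ r *ₚ ((p *ₚ q) ∘ₚ r))
    ≈⟨ +ₚ-cong (∘ₚ-scale a q r) (+ₚ-cong 0∷0≋0 (*ₚ-congˡ r (∘ₚ-*ₚ p q r))) ⟩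
  const a *ₚ (q ∘ₚ r) +ₚ r *ₚ ((p ∘ₚ r) *ₚ (q ∘ₚ r))
    ≈⟨ rearrange (const a) r (p ∘ₚ r) (q ∘ₚ r) ⟩
  ((a ∷ p) ∘ₚ r) *ₚ (q ∘ₚ r)  ∎
  where
  rearrange : ∀ a r s t → a *ₚ t +ₚ r *ₚ (s *ₚ t) ≋ (a +ₚ r *ₚ s) *ₚ t
  rearrange = solve-∀ ℤ[x]

const-∘ₚ : ∀ a r → const a ∘ₚ r ≋ const a
const-∘ₚ a r = ≋.trans (+ₚ-congˡ (const a) (*ₚ-zeroʳ r)) (≋.reflexive (+ₚ-identityʳ (const a)))

X-∘ₚ : ∀ r → X ∘ₚ r ≋ r
X-∘ₚ r = ≋.trans (+ₚ-cong 0∷0≋0 (*ₚ-congˡ r (const-∘ₚ 1ℤ r)))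
                 (≋.trans (*ₚ-comm r 1ₚ) (*ₚ-identityˡ r))

-- Chebyshev polynomials

2X : Poly
2X = const (+ 2) *ₚ X

chebyshev-∘ₚ : ∀ p q r → (2X *ₚ p -ₚ q) ∘ₚ r ≋ const (+ 2) *ₚ r *ₚ (p ∘ₚ r) -ₚ q ∘ₚ r
chebyshev-∘ₚ p q r = begin
  (2X *ₚ p -ₚ q) ∘ₚ r
    ≈⟨ ∘ₚ-+ₚ (2X *ₚ p) (-ₚ q) r ⟩
  (2X *ₚ p) ∘ₚ r +ₚ (-ₚ q) ∘ₚ r
    ≈⟨ +ₚ-cong (∘ₚ-*ₚ 2X p r) (∘ₚ--ₚ q r) ⟩
  (2X ∘ₚ r) *ₚ (p ∘ₚ r) -ₚ q ∘ₚ r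
    ≈⟨ +ₚ-congʳ _ (*ₚ-congʳ _ (∘ₚ-*ₚ (const (+ 2)) X r)) ⟩
  (const (+ 2) ∘ₚ r) *ₚ (X ∘ₚ r) *ₚ (p ∘ₚ r) -ₚ q ∘ₚ r
    ≈⟨ +ₚ-congʳ _ (*ₚ-congʳ _ (*ₚ-cong (const-∘ₚ (+ 2) r) (X-∘ₚ r))) ⟩
  const (+ 2) *ₚ r *ₚ (p ∘ₚ r) -ₚ q ∘ₚ r  ∎

-- The shift avoids subtraction on indices and admits `m = 1`, where U_{m-2} / U_{m-1} = 0 starts
-- the telescoping.
W : ℕ → Poly
W zero          = -ₚ 1ₚ
W (suc zero)    = 0ₚ
W (suc (suc n)) = U n

W-rec : ∀ n → W (suc (suc n)) ≋ 2X *ₚ W (suc n) -ₚ W n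
W-rec zero          = ≋.sym (+ₚ-congʳ _ (*ₚ-zeroʳ 2X))
W-rec (suc zero)    = rearrange 2X
  where
  rearrange : ∀ c → c ≋ c *ₚ 1ₚ -ₚ 0ₚ
  rearrange = solve-∀ ℤ[x]
W-rec (suc (suc n)) = ≋.refl

-- With x = cos θ, `W n` is sin((n-1)θ) / sin θ, so this is the product-to-sum formula for 2 cos(mθ)
-- sin((m+i-1)θ).
2T*W : ∀ m i → const (+ 2) *ₚ T m *ₚ W (m + i) ≋ W (m + (m + i)) +ₚ W i
2T*W zero       i = rearrange (W i)
  where
  rearrange : ∀ w → const (+ 2) *ₚ 1ₚ *ₚ w ≋ w +ₚ w
  rearrange = solve-∀ ℤ[x]
2T*W (suc zero) i = ≋.trans (rearrange (2X *ₚ W (suc i)) (W i))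
                            (+ₚ-congʳ _ (≋.sym (W-rec i)))
  where
  rearrange : ∀ s t → s ≋ (s -ₚ t) +ₚ t
  rearrange = solve-∀ ℤ[x]
2T*W (suc (suc m)) i
  -- The offsets `i + 1` and `i + 2` give both hypotheses the same factor `w`. The rewrites bring
  -- all indices to a numeral plus `i`, `m + i` or `e`.
  with hyp₁ ← 2T*W (suc m) (suc i) | hyp₀ ← 2T*W m (suc (suc i))
  rewrite ℕ.+-suc m (suc i) | ℕ.+-suc m i
        | ℕ.+-suc m (suc (m + i)) | ℕ.+-suc m (m + i) = begin
  two *ₚ (2X *ₚ T (suc m) -ₚ T m) *ₚ w
    ≈⟨ expand two 2X (T (suc m)) (T m) w ⟩
  2X *ₚ (two *ₚ T (suc m) *ₚ w) -ₚ two *ₚ T m *ₚ w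
    ≈⟨ +ₚ-cong (*ₚ-congˡ 2X hyp₁) (-ₚ-cong hyp₀) ⟩
  2X *ₚ (W (3 + e) +ₚ W (1 + i)) -ₚ (W (2 + e) +ₚ W (2 + i))
    ≈⟨ +ₚ-congˡ _ (-ₚ-cong (+ₚ-congˡ (W (2 + e)) (W-rec i))) ⟩
  2X *ₚ (W (3 + e) +ₚ W (1 + i)) -ₚ (W (2 + e) +ₚ (2X *ₚ W (1 + i) -ₚ W i))
    ≈⟨ collect 2X (W (3 + e)) (W (2 + e)) (W (1 + i)) (W i) ⟩
  -- The bracket is `W (4 + e)` by definition.
  (2X *ₚ W (3 + e) -ₚ W (2 + e)) +ₚ W i  ∎
  where
  two = const (+ 2)
  w   = W (2 + (m + i))
  e   = m + (m + i)
  expand : ∀ two c s t w → two *ₚ (c *ₚ s -ₚ t) *ₚ w ≋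
                           c *ₚ (two *ₚ s *ₚ w) -ₚ two *ₚ t *ₚ w
  expand = solve-∀ ℤ[x]
  collect : ∀ c p q r s → c *ₚ (p +ₚ r) -ₚ (q +ₚ (c *ₚ r -ₚ s)) ≋ (c *ₚ p -ₚ q) +ₚ s
  collect = solve-∀ ℤ[x]

W-∘ₚ-rec : ∀ k r → W (suc (suc k)) ∘ₚ r ≋ const (+ 2) *ₚ r *ₚ (W (suc k) ∘ₚ r) -ₚ W k ∘ₚ r
W-∘ₚ-rec zero r = ≋.sym (begin
  const (+ 2) *ₚ r *ₚ 0ₚ -ₚ (const (ℤ.- 1ℤ) ∘ₚ r)
    ≈⟨ +ₚ-cong (*ₚ-zeroʳ (const (+ 2) *ₚ r)) (-ₚ-cong (const-∘ₚ (ℤ.- 1ℤ) r)) ⟩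
  1ₚ           ≈⟨ const-∘ₚ 1ℤ r ⟨
  1ₚ ∘ₚ r      ∎)
W-∘ₚ-rec (suc zero) r = begin
  2X ∘ₚ r                                    ≈⟨ ∘ₚ-*ₚ (const (+ 2)) X r ⟩
  (const (+ 2) ∘ₚ r) *ₚ (X ∘ₚ r)             ≈⟨ *ₚ-cong (const-∘ₚ (+ 2) r) (X-∘ₚ r) ⟩
  const (+ 2) *ₚ r                           ≈⟨ rearrange (const (+ 2) *ₚ r) ⟩
  const (+ 2) *ₚ r *ₚ 1ₚ -ₚ 0ₚ               ≈⟨ +ₚ-congʳ _ (*ₚ-congˡ (const (+ 2) *ₚ r) (const-∘ₚ 1ℤ r)) ⟨
  const (+ 2) *ₚ r *ₚ (1ₚ ∘ₚ r) -ₚ 0ₚ        ∎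
  where
  rearrange : ∀ s → s ≋ s *ₚ 1ₚ -ₚ 0ₚ
  rearrange = solve-∀ ℤ[x]
W-∘ₚ-rec (suc (suc k)) r = chebyshev-∘ₚ (U (suc k)) (U k) r

-- Both sides satisfy y_{k+2} = 2 T_m y_{k+1} - y_k: the left by `2T*W` at `i = k * m + j`, the
-- right by `W-∘ₚ-rec`. Agreement at k = 0 and k = 1 then suffices.
W-* : ∀ m j k → W (k * m + j) ≋ (W (suc k) ∘ₚ T m) *ₚ W (m + j) -ₚ (W k ∘ₚ T m) *ₚ W j
W-* m j zero = ≋.sym (begin
  -- `W 1` is `0ₚ`, so the first product has vanished by computation.
  -ₚ ((const (ℤ.- 1ℤ) ∘ₚ T m) *ₚ W j)  ≈⟨ -ₚ-cong (*ₚ-congʳ _ (const-∘ₚ (ℤ.- 1ℤ) (T m))) ⟩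
  -ₚ ((-ₚ 1ₚ) *ₚ W j)                 ≈⟨ rearrange (W j) ⟩
  W j                                 ∎)
  where
  rearrange : ∀ w → -ₚ ((-ₚ 1ₚ) *ₚ w) ≋ w
  rearrange = solve-∀ ℤ[x]
W-* m j (suc zero) rewrite ℕ.+-identityʳ m = ≋.sym (begin
  (1ₚ ∘ₚ T m) *ₚ W (m + j) -ₚ 0ₚ  ≈⟨ +ₚ-congʳ _ (*ₚ-congʳ _ (const-∘ₚ 1ℤ (T m))) ⟩
  1ₚ *ₚ W (m + j) -ₚ 0ₚ           ≈⟨ rearrange (W (m + j)) ⟩
  W (m + j)                       ∎)
  where
  rearrange : ∀ w → 1ₚ *ₚ w -ₚ 0ₚ ≋ w
  rearrange = solve-∀ ℤ[x]
W-* m j (suc (suc k))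
  with hyp₁ ← W-* m j (suc k)
  rewrite ℕ.+-assoc m (m + k * m) j | ℕ.+-assoc m (k * m) j = begin
  W (m + (m + i))
    ≈⟨ isolate (W (m + (m + i))) (W i) ⟩
  (W (m + (m + i)) +ₚ W i) -ₚ W i
    ≈⟨ +ₚ-congʳ _ (2T*W m i) ⟨
  2t *ₚ W (m + i) -ₚ W i
    ≈⟨ +ₚ-cong (*ₚ-congˡ 2t hyp₁) (-ₚ-cong (W-* m j k)) ⟩
  2t *ₚ (w₂ *ₚ u -ₚ w₁ *ₚ v) -ₚ (w₁ *ₚ u -ₚ w₀ *ₚ v)
    ≈⟨ collect 2t w₂ w₁ w₀ u v ⟩
  (2t *ₚ w₂ -ₚ w₁) *ₚ u -ₚ (2t *ₚ w₁ -ₚ w₀) *ₚ v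
    ≈⟨ +ₚ-cong (*ₚ-congʳ _ (W-∘ₚ-rec (suc k) (T m))) (-ₚ-cong (*ₚ-congʳ _ (W-∘ₚ-rec k (T m)))) ⟨
  (W (3 + k) ∘ₚ T m) *ₚ u -ₚ w₂ *ₚ v  ∎
  where
  i  = k * m + j
  2t = const (+ 2) *ₚ T m
  u  = W (m + j)
  v  = W j
  w₀ = W k ∘ₚ T m
  w₁ = W (1 + k) ∘ₚ T m
  w₂ = W (2 + k) ∘ₚ T m
  isolate : ∀ s t → s ≋ (s +ₚ t) -ₚ t
  isolate = solve-∀ ℤ[x]
  collect : ∀ c w₂ w₁ w₀ u v →
            c *ₚ (w₂ *ₚ u -ₚ w₁ *ₚ v) -ₚ (w₁ *ₚ u -ₚ w₀ *ₚ v) ≋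
            (c *ₚ w₂ -ₚ w₁) *ₚ u -ₚ (c *ₚ w₁ -ₚ w₀) *ₚ v
  collect = solve-∀ ℤ[x]

-- In `W-*` with `j = 1` the second product disappears because `W 1` is zero.
U-pred-* : ∀ d m → W (suc (suc d * m)) ≋ (U d ∘ₚ T m) *ₚ W (suc m)
U-pred-* d m = begin
  W (suc (suc d * m))
    ≡⟨ cong W (ℕ.+-comm 1 (suc d * m)) ⟩
  W (suc d * m + 1)
    ≈⟨ W-* m 1 (suc d) ⟩
  (U d ∘ₚ T m) *ₚ W (m + 1) -ₚ (W (suc d) ∘ₚ T m) *ₚ 0ₚ
    ≈⟨ +ₚ-congˡ _ (-ₚ-cong (*ₚ-zeroʳ (W (suc d) ∘ₚ T m))) ⟩
  (U d ∘ₚ T m) *ₚ W (m + 1) +ₚ 0ₚ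
    ≡⟨ +ₚ-identityʳ _ ⟩
  (U d ∘ₚ T m) *ₚ W (m + 1)
    ≡⟨ cong (λ i → (U d ∘ₚ T m) *ₚ W i) (ℕ.+-comm m 1) ⟩
  (U d ∘ₚ T m) *ₚ W (suc m)  ∎

-- In `W-*` with `j = 0` the value -1 of `W 0` turns the subtraction into an addition.
U-pred²-* : ∀ d m → W (suc d * m) ≋ (U d ∘ₚ T m) *ₚ W m +ₚ W (suc d) ∘ₚ T m
U-pred²-* d m = begin
  W (suc d * m)
    ≡⟨ cong W (ℕ.+-identityʳ (suc d * m)) ⟨
  W (suc d * m + 0)
    ≈⟨ W-* m 0 (suc d) ⟩
  (U d ∘ₚ T m) *ₚ W (m + 0) -ₚ (W (suc d) ∘ₚ T m) *ₚ (-ₚ 1ₚ)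
    ≡⟨ cong (λ i → (U d ∘ₚ T m) *ₚ W i -ₚ (W (suc d) ∘ₚ T m) *ₚ (-ₚ 1ₚ)) (ℕ.+-identityʳ m) ⟩
  (U d ∘ₚ T m) *ₚ W m -ₚ (W (suc d) ∘ₚ T m) *ₚ (-ₚ 1ₚ)
    ≈⟨ rearrange (U d ∘ₚ T m) (W m) (W (suc d) ∘ₚ T m) ⟩
  (U d ∘ₚ T m) *ₚ W m +ₚ W (suc d) ∘ₚ T m  ∎
  where
  rearrange : ∀ q w u → q *ₚ w -ₚ u *ₚ (-ₚ 1ₚ) ≋ q *ₚ w +ₚ u
  rearrange = solve-∀ ℤ[x]

-- Telescoping

module _ (d : ℕ) where

  open RatFun

  factor : ℕ → RatFun
  factor j = 1ₚ / U d ∘ₚ T (suc d ^ j) ⟨ U∘T≉0 d (suc d ^ j) ⟩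

  -- For d ≥ 1, `W (suc d)` is U_{d-1}; this form needs no case split on `d`.
  term : ℕ → RatFun
  term k = ι (W (suc d) ∘ₚ T (suc d ^ k)) *ᶠ prod≤ k factor

  num-prod : ∀ k → num (prod≤ k factor) ≋ 1ₚ
  num-prod zero    = ≋.refl
  num-prod (suc k) = *ₚ-congʳ _ (num-prod k)

  -- By `U-pred-*`, each new factor multiplies U_{m-1} into U_{(d+1)m-1}; the chain starts at m = 1
  -- with U_0 = 1.
  den-prod : ∀ k → den (prod≤ k factor) ≋ W (suc (suc d ^ suc k))
  den-prod zero    = ≋.sym (≋.trans (U-pred-* d 1) (≋.trans (*ₚ-comm _ 1ₚ) (*ₚ-identityˡ _)))
  den-prod (suc k) = begin
    den (prod≤ k factor) *ₚ q   ≈⟨ *ₚ-congʳ _ (den-prod k) ⟩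
    W (suc m) *ₚ q              ≈⟨ *ₚ-comm (W (suc m)) q ⟩
    q *ₚ W (suc m)              ≈⟨ U-pred-* d m ⟨
    W (suc (suc d * m))         ∎
    where
    m = suc d ^ suc k
    q = U d ∘ₚ T m

  -- The closed form of the partial sum in the cross-multiplied shape of `_≈ᶠ_`. The denominator of
  -- the sum stays unreduced, so no cancellation is required.
  sum-term : ∀ n → num (sum≤ n term) *ₚ W (suc (suc d ^ suc n)) ≋
                   W (suc d ^ suc n) *ₚ den (sum≤ n term)
  sum-term zero = begin
    (u *ₚ 1ₚ) *ₚ W (suc (suc d * 1))  ≈⟨ *ₚ-congˡ (u *ₚ 1ₚ) (den-prod 0) ⟨
    (u *ₚ 1ₚ) *ₚ q                    ≈⟨ rearrange q u ⟩
    -- Here `0ₚ` is `W 1`, the value of `W m` at `m = 1`.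
    (q *ₚ 0ₚ +ₚ u) *ₚ (1ₚ *ₚ q)       ≈⟨ *ₚ-congʳ _ (U-pred²-* d 1) ⟨
    W (suc d * 1) *ₚ (1ₚ *ₚ q)        ∎
    where
    u = W (suc d) ∘ₚ T 1
    q = U d ∘ₚ T 1
    rearrange : ∀ q u → (u *ₚ 1ₚ) *ₚ q ≋ (q *ₚ 0ₚ +ₚ u) *ₚ (1ₚ *ₚ q)
    rearrange = solve-∀ ℤ[x]
  sum-term (suc n) = begin
    -- The numerator of `s / t` plus the new term; `1ₚ` is the denominator contributed by `ι`.
    (s *ₚ (1ₚ *ₚ D) +ₚ (u *ₚ N) *ₚ t) *ₚ W (suc (suc d * m))
      ≈⟨ *ₚ-cong (+ₚ-cong (*ₚ-congˡ s (*ₚ-congˡ 1ₚ D≋qv))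
                          (*ₚ-congʳ t (*ₚ-congˡ u (num-prod (suc n)))))
                 (U-pred-* d m) ⟩
    (s *ₚ (1ₚ *ₚ (q *ₚ v)) +ₚ (u *ₚ 1ₚ) *ₚ t) *ₚ (q *ₚ v)
      ≈⟨ expand s t u q v ⟩
    (q *ₚ (s *ₚ v) +ₚ u *ₚ t) *ₚ (q *ₚ v)
      ≈⟨ *ₚ-congʳ (q *ₚ v) (+ₚ-congʳ (u *ₚ t) (*ₚ-congˡ q (sum-term n))) ⟩
    (q *ₚ (W m *ₚ t) +ₚ u *ₚ t) *ₚ (q *ₚ v)
      ≈⟨ collect (W m) t u q v ⟩
    (q *ₚ W m +ₚ u) *ₚ (t *ₚ (1ₚ *ₚ (q *ₚ v)))
      ≈⟨ *ₚ-cong (U-pred²-* d m) (*ₚ-congˡ t (*ₚ-congˡ 1ₚ D≋qv)) ⟨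
    W (suc d * m) *ₚ (t *ₚ (1ₚ *ₚ D))  ∎
    where
    m = suc d ^ suc n
    s = num (sum≤ n term)
    t = den (sum≤ n term)
    N = num (prod≤ (suc n) factor)
    D = den (prod≤ (suc n) factor)
    u = W (suc d) ∘ₚ T m
    q = U d ∘ₚ T m
    v = W (suc m)
    D≋qv : D ≋ q *ₚ v
    D≋qv = ≋.trans (den-prod (suc n)) (U-pred-* d m)
    expand : ∀ s t u q v → (s *ₚ (1ₚ *ₚ (q *ₚ v)) +ₚ (u *ₚ 1ₚ) *ₚ t) *ₚ (q *ₚ v) ≋
                           (q *ₚ (s *ₚ v) +ₚ u *ₚ t) *ₚ (q *ₚ v)
    expand = solve-∀ ℤ[x]
    collect : ∀ y t u q v → (q *ₚ (y *ₚ t) +ₚ u *ₚ t) *ₚ (q *ₚ v) ≋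
                            (q *ₚ y +ₚ u) *ₚ (t *ₚ (1ₚ *ₚ (q *ₚ v)))
    collect = solve-∀ ℤ[x]

-- Return from shifted indices to truncated subtraction.

W≡U-pred² : ∀ {m} → 2 ≤ m → W m ≡ U (m ∸ 2)
W≡U-pred² (s≤s (s≤s _)) = refl

W≡U-pred : ∀ {m} → 1 ≤ m → W (suc m) ≡ U (m ∸ 1)
W≡U-pred (s≤s _) = refl

theorem1p3 : ∀ (n d : ℕ) → 1 ≤ d →
    (∑[ k ≤ n ] (ι (U (d ∸ 1) ∘ₚ T ((d + 1) ^ k))
    *ᶠ (∏[ j ≤ k ] (1ₚ / U d ∘ₚ T ((d + 1) ^ j) ⟨ U∘T≉0 d ((d + 1) ^ j) ⟩))))
    ≈ᶠ (U ((d + 1) ^ (n + 1) ∸ 2) / U ((d + 1) ^ (n + 1) ∸ 1) ⟨ U≉0 ((d + 1) ^ (n + 1) ∸ 1) ⟩)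
-- Once `d` is a successor, `U (d ∸ 1)` and `W (suc d)` agree by computation, so the stated sum
-- becomes `S`.
theorem1p3 n (suc d) (s≤s z≤n) rewrite ℕ.+-comm d 1 | ℕ.+-comm n 1
  = coeff-≡ (subst₂ (λ p q → RatFun.num S *ₚ p ≋ q *ₚ RatFun.den S)
              (W≡U-pred (ℕ.≤-trans (s≤s z≤n) 2≤M)) (W≡U-pred² 2≤M) (sum-term (suc d) n))
  where
  S = sum≤ n (term (suc d))
  2≤M : 2 ≤ suc (suc d) ^ suc n
  -- The power splits as base times n-th power, the base being at least 2 and the n-th power at
  -- least 1.
  2≤M = ℕ.*-mono-≤ {2} {suc (suc d)} {1} (s≤s (s≤s z≤n)) (ℕ.m^n>0 (suc (suc d)) n)
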